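{- Assume the following principle (DW): for every tall Borel ideal $\mathcal I$ on $\omega$ whose quotient $\mathbb Q_{\mathcal I}$ adds a real, there are a $\mathbb Q_{\mathcal I}$-name for a new real and a set $X\in\mathcal I^+$ such that the name has countable width below $X$. Then there is no tall Borel ideal on $\omega$ with the Ramsey property.
   Context: All ideals on $\omega$ are proper and contain all finite sets; they are viewed as subsets of $2^\omega\cong\mathcal P(\omega)$, so "Borel" makes sense. $\mathcal I^+=\mathcal P(\omega)\setminus\mathcal I$. An ideal is tall if every infinite subset of $\omega$ has an infinite subset in the ideal. $\mathcal I$ has the Ramsey property if for every $X\in\mathcal I^+$ and every $c:[X]^2\to2$ there is $Y\subseteq X$, $Y\in\mathcal I^+$, with $c\upharpoonright[Y]^2$ constant. $\mathbb Q_{\mathcal I}=\mathcal P(\omega)/\mathcal I$ is the quotient forcing: conditions are the $\mathcal I$-positive sets, $A\le B\iff A\setminus B\in\mathcal I$, and $A\perp B\iff A\cap B\in\mathcal I$. A name for a new real is a $\mathbb Q_{\mathcal I}$-name $\dot r$ for an element of $2^\omega$ which is forced (by every condition) not to belong to the ground model; $\mathbb Q_{\mathcal I}$ adds a real if such a name exists. A name $\dot r$ for a new real has countable width below $X$ if there are maximal antichains $(\mathcal A_n)_{n\in\omega}$ of $\mathbb Q_{\mathcal I}$, with $\mathcal A_{n+1}$ refining $\mathcal A_n$ and each $A\in\mathcal A_n$ deciding $\dot r\upharpoonright n$, such that $\{A\in\mathcal A_n:A\cap X\in\mathcal I^+\}$ is countable for every $n$. -}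

module Defs where

open import Data.Bool.Base using (Bool; true; false; _∧_; _∨_; not)
open import Data.Fin.Base using (toℕ)
open import Data.List.Base using (List)
open import Data.List.Membership.Propositional using () renaming (_∈_ to _∈ˡ_)
open import Data.Nat.Base using (ℕ; suc; _<_)
open import Data.Product.Base using (Σ; ∃; _×_; proj₁)
open import Data.Vec.Base using (Vec; lookup)
open import Level using (0ℓ)
open import Relation.Binary.PropositionalEquality using (_≡_; _≗_)
open import Relation.Nullary.Negation using (¬_)
open import Relation.Unary using (Pred; _∈_; _⊆_; _≐_; ∁; ⋃)

------------------------------------------------------------------------
-- Subsets of ω

-- Subsets of ω are points of 2^ω; equality of subsets is pointwise (_≗_).
𝒫ω : Set
𝒫ω = ℕ → Bool

El : 𝒫ω → Pred ℕ 0ℓ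
El A n = A n ≡ true

infixr 7 _∩ω_
infixr 6 _∪ω_
infix  7 _∖ω_

_∩ω_ _∪ω_ _∖ω_ : 𝒫ω → 𝒫ω → 𝒫ω
(A ∩ω B) n = A n ∧ B n
(A ∪ω B) n = A n ∨ B n
(A ∖ω B) n = A n ∧ not (B n)

Finite : 𝒫ω → Set
Finite A = ∃ λ (xs : List ℕ) → ∀ n → n ∈ El A → n ∈ˡ xs

Infinite : 𝒫ω → Set
Infinite A = ¬ Finite A

------------------------------------------------------------------------
-- Borel subsets of the Cantor space

Open : Pred 𝒫ω 0ℓ → Set
Open U = ∀ x → x ∈ U → ∃ λ n → ∀ y → (∀ m → m < n → x m ≡ y m) → y ∈ U

-- The σ-algebra generated by the open sets.  The constructor `resp` makes the
-- notion independent of the predicate chosen to represent a set of points.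
data Borel : Pred 𝒫ω 0ℓ → Set₁ where
  open-set   : ∀ {U} → Open U → Borel U
  complement : ∀ {U} → Borel U → Borel (∁ U)
  union      : ∀ {U : ℕ → Pred 𝒫ω 0ℓ} → (∀ n → Borel (U n)) → Borel (⋃ ℕ U)
  resp       : ∀ {U V} → U ≐ V → Borel U → Borel V

------------------------------------------------------------------------
-- Ideals

record IsIdeal (I : Pred 𝒫ω 0ℓ) : Set where
  field
    downward : ∀ A B → El A ⊆ El B → B ∈ I → A ∈ I
    ∪-closed : ∀ A B → A ∈ I → B ∈ I → (A ∪ω B) ∈ I
    finite   : ∀ A → Finite A → A ∈ I
    proper   : ¬ ((λ _ → true) ∈ I)

infix 9 _⁺

_⁺ : Pred 𝒫ω 0ℓ → Pred 𝒫ω 0ℓ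
I ⁺ = ∁ I

Tall : Pred 𝒫ω 0ℓ → Set
Tall I = ∀ A → Infinite A → ∃ λ B → El B ⊆ El A × Infinite B × B ∈ I

-- A colouring of [X]² is given by a total c : ℕ → ℕ → Bool, of which only the
-- values c m n with m < n and m, n ∈ X are used: c m n is the colour of {m, n}.
HomogeneousFor : (ℕ → ℕ → Bool) → 𝒫ω → Set
HomogeneousFor c Y =
  ∃ λ i → ∀ m n → m ∈ El Y → n ∈ El Y → m < n → c m n ≡ i

Ramsey : Pred 𝒫ω 0ℓ → Set
Ramsey I = ∀ X → X ∈ I ⁺ → (c : ℕ → ℕ → Bool) →
  ∃ λ Y → El Y ⊆ El X × Y ∈ I ⁺ × HomogeneousFor c Y

------------------------------------------------------------------------
-- The quotient forcing

module Forcing (I : Pred 𝒫ω 0ℓ) where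

  ℚ : Set
  ℚ = ∃ λ A → A ∈ I ⁺

  infix 4 _≼_ _⊥_

  _≼_ : ℚ → ℚ → Set
  p ≼ q = (proj₁ p ∖ω proj₁ q) ∈ I

  _⊥_ : ℚ → ℚ → Set
  p ⊥ q = (proj₁ p ∩ω proj₁ q) ∈ I

  DenseBelow : ℚ → Pred ℚ 0ℓ → Set
  DenseBelow p D = ∀ q → q ≼ p → ∃ λ r → r ≼ q × r ∈ D

  -- Nice names for subsets of ω × 2: such a τ stands for the name
  -- { (⟨n, i⟩ˇ , s) : s ∈ τ n i }.
  Name : Set₁
  Name = ℕ → Bool → Pred ℚ 0ℓ

  -- p ⊩ τ ⟨ n ⟩≈ i  says that p forces ⟨n, i⟩ˇ ∈ τ, i.e. τ(n) = i when τ is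
  -- forced to be a function.
  infix 4 _⊩_⟨_⟩≈_ _⊩_≈ˇ_ _⊩_≉ˇ_

  _⊩_⟨_⟩≈_ : ℚ → Name → ℕ → Bool → Set
  p ⊩ τ ⟨ n ⟩≈ i = DenseBelow p λ r → ∃ λ s → s ∈ τ n i × r ≼ s

  -- Every condition forces that τ is a function from ω to 2.
  record IsRealName (τ : Name) : Set where
    field
      total        : ∀ p n → DenseBelow p λ q → ∃ λ i → q ⊩ τ ⟨ n ⟩≈ i
      single-value : ∀ p n → ¬ (p ⊩ τ ⟨ n ⟩≈ true × p ⊩ τ ⟨ n ⟩≈ false)

  _⊩_≈ˇ_ : ℚ → Name → (ℕ → Bool) → Set
  p ⊩ τ ≈ˇ x = ∀ n → p ⊩ τ ⟨ n ⟩≈ x n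

  _⊩_≉ˇ_ : ℚ → Name → (ℕ → Bool) → Set
  p ⊩ τ ≉ˇ x = ∀ q → q ≼ p → ¬ (q ⊩ τ ≈ˇ x)

  -- Every condition forces that τ is an element of 2^ω outside the ground
  -- model, whose reals are the x : ℕ → Bool.
  record IsNewRealName (τ : Name) : Set where
    field
      isRealName : IsRealName τ
      new        : ∀ p x → p ⊩ τ ≉ˇ x

  AddsReal : Set₁
  AddsReal = ∃ λ τ → IsNewRealName τ

  record IsMaximalAntichain (𝒜 : Pred ℚ 0ℓ) : Set where
    field
      antichain : ∀ p q → p ∈ 𝒜 → q ∈ 𝒜 → ¬ (proj₁ p ≗ proj₁ q) → p ⊥ q
      maximal   : ∀ p → ∃ λ q → q ∈ 𝒜 × ¬ (p ⊥ q)

  Refines : Pred ℚ 0ℓ → Pred ℚ 0ℓ → Set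
  Refines 𝒜 ℬ = ∀ p → p ∈ 𝒜 → ∃ λ q → q ∈ ℬ × p ≼ q

  -- p decides the restriction of τ to n = {0, …, n-1}.
  Decides : ℚ → Name → ℕ → Set
  Decides p τ n = ∃ λ (s : Vec Bool n) → ∀ k → p ⊩ τ ⟨ toℕ k ⟩≈ lookup s k

  -- At most countable: contained in the range of a sequence.  The empty family
  -- is included, as ℚ is inhabited when I is proper.
  Countable : Pred ℚ 0ℓ → Set
  Countable 𝒮 =
    ∃ λ (e : ℕ → ℚ) → ∀ p → p ∈ 𝒮 → ∃ λ n → proj₁ (e n) ≗ proj₁ p

  record CountableWidthBelow (τ : Name) (X : 𝒫ω) : Set₁ where
    field
      𝒜         : ℕ → Pred ℚ 0ℓ
      maximal   : ∀ n → IsMaximalAntichain (𝒜 n)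
      refining  : ∀ n → Refines (𝒜 (suc n)) (𝒜 n)
      deciding  : ∀ n p → p ∈ 𝒜 n → Decides p τ n
      countable : ∀ n → Countable λ p → p ∈ 𝒜 n × (proj₁ p ∩ω X) ∈ I ⁺

open Forcing public using (AddsReal; Name; IsNewRealName; CountableWidthBelow)

DW : Set₁
DW = ∀ I → IsIdeal I → Tall I → Borel I → AddsReal I →
  Σ (Name I) λ τ → IsNewRealName I τ ×
    ∃ λ X → X ∈ I ⁺ × CountableWidthBelow I τ X

{-# OPTIONS --safe #-}
module Submission where

-- Let I be tall, Borel and Ramsey.  If a name for a new real had countable width
-- below X, separating the countably many decided values modulo I would give reals
-- r k (k ∈ X) such that a positive Y ⊆ X decides the name at n as soon as r k n is
-- constant for almost all k ∈ Y.  Colouring {m < k} by the lexicographic order of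
-- r m and r k yields such a Y for all n at once, a contradiction.  So, by (DW), the
-- quotient adds no real, for I and for all its restrictions to positive sets.
--
-- Coding the elements that the generic ultrafilter picks from countably many
-- maximal antichains by a real, it follows that the quotient is ω-distributive,
-- and together with the Ramsey property that I⁺ is selective.  As in Mathias'
-- theorem, every Borel set U then has a positive Y such that all infinite subsets
-- of Y lie in U or none does.  For U = I this contradicts positivity or tallness.

open import Defs
open import Axiom.ExcludedMiddle using (ExcludedMiddle)
open import Axiom.Extensionality.Propositional using (Extensionality)
open import Data.Bool.Base using (Bool; true; false; _∧_; _∨_; not; if_then_else_; T)
open import Data.Bool.Properties
  using (∧-conicalˡ; ∧-conicalʳ; ∨-zeroʳ; ¬-not; not-¬; not-injective) renaming (_≟_ to _≟ᵇ_)
open import Data.Empty using (⊥-elim) renaming (⊥ to Absurdity)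
open import Data.Fin.Base using (fromℕ)
open import Data.Fin.Properties using (toℕ-fromℕ)
open import Data.List.Base using ([]; _++_; upTo)
open import Data.List.Membership.Propositional.Properties
  using (∈-upTo⁺; ∈-upTo⁻; ∈-++⁺ˡ; ∈-++⁺ʳ)
open import Data.Nat.Base using (ℕ; zero; suc; _+_; _≤_; _<_; _<ᵇ_; z≤n; s≤s)
open import Data.Nat.Induction using (<-rec)
open import Data.Nat.Properties
open import Data.Product.Base using (∃; _×_; _,_; proj₁; proj₂)
open import Data.Sum.Base using (_⊎_; inj₁; inj₂)
open import Data.Vec.Base using (lookup)
open import Function.Base using (_∘_; id; const; case_of_)
open import Level using (0ℓ; Lift; lift; lower)
open import Relation.Binary.Definitions using (tri<; tri≈; tri>)
open import Relation.Binary.PropositionalEquality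
  using (_≡_; refl; sym; trans; cong; cong₂; subst)
open import Relation.Nullary.Decidable
  using (Dec; yes; no; does; map′; dec-true; dec-false; decidable-stable)
open import Relation.Nullary.Negation using (¬_; contradiction)
open import Relation.Unary using (Pred; _∈_; _⊆_; ∁; ⋃)

-- Membership in subsets of ω

∈∩⁺ : ∀ A B {n} → n ∈ El A → n ∈ El B → n ∈ El (A ∩ω B)
∈∩⁺ A B p q = cong₂ _∧_ p q

∈∩ˡ : ∀ A B {n} → n ∈ El (A ∩ω B) → n ∈ El A
∈∩ˡ A B {n} = ∧-conicalˡ (A n) (B n)

∈∩ʳ : ∀ A B {n} → n ∈ El (A ∩ω B) → n ∈ El B
∈∩ʳ A B {n} = ∧-conicalʳ (A n) (B n)

∈∪ˡ : ∀ A B {n} → n ∈ El A → n ∈ El (A ∪ω B)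
∈∪ˡ A B {n} p = cong (_∨ B n) p

∈∪ʳ : ∀ A B {n} → n ∈ El B → n ∈ El (A ∪ω B)
∈∪ʳ A B {n} p = trans (cong (A n ∨_) p) (∨-zeroʳ (A n))

∈∖⁺ : ∀ A B {n} → n ∈ El A → ¬ (n ∈ El B) → n ∈ El (A ∖ω B)
∈∖⁺ A B p q = cong₂ _∧_ p (cong not (¬-not q))

∈∖ˡ : ∀ A B {n} → n ∈ El (A ∖ω B) → n ∈ El A
∈∖ˡ A B {n} = ∧-conicalˡ (A n) (not (B n))

∈∖ʳ : ∀ A B {n} → n ∈ El (A ∖ω B) → ¬ (n ∈ El B)
∈∖ʳ A B {n} p q = not-¬ (not-injective {y = false} (∧-conicalʳ (A n) (not (B n)) p)) q

infix 4 _⊆[_]_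

_⊆[_]_ : 𝒫ω → ℕ → 𝒫ω → Set
B ⊆[ N ] A = ∀ {n} → N ≤ n → n ∈ El B → n ∈ El A

below : ℕ → 𝒫ω
below N k = k <ᵇ N

∈below⁺ : ∀ {k N} → k < N → k ∈ El (below N)
∈below⁺ {zero} (s≤s _) = refl
∈below⁺ {suc k} (s≤s p) = ∈below⁺ p

∈below⁻ : ∀ {k N} → k ∈ El (below N) → k < N
∈below⁻ {k} {N} p = <ᵇ⇒< k N (subst T (sym p) _)

below-≡false : ∀ {k N} → N ≤ k → below N k ≡ false
below-≡false p = ¬-not (λ q → <⇒≱ (∈below⁻ q) p)

below-finite : ∀ N → Finite (below N)
below-finite N = upTo N , λ _ p → ∈-upTo⁺ (∈below⁻ p)

Infinite-∩ : ∀ {N} A B → B ⊆[ N ] A → Infinite B → Infinite (B ∩ω A)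
Infinite-∩ {N} A B sub inf (xs , h) = inf (upTo N ++ xs , λ n p → case <-≤-connex n N of λ where
  (inj₁ n<N) → ∈-++⁺ˡ (∈-upTo⁺ n<N)
  (inj₂ N≤n) → ∈-++⁺ʳ (upTo N) (h n (∈∩⁺ B A p (sub N≤n p))))

-- Continuous maps and Borel preimages

Agree : ℕ → 𝒫ω → 𝒫ω → Set
Agree n x y = ∀ m → m < n → x m ≡ y m

Agree-suc : ∀ {n x y} → Agree n x y → x n ≡ y n → Agree (suc n) x y
Agree-suc h e m m<1+n with m<1+n⇒m<n∨m≡n m<1+n
... | inj₁ m<n  = h m m<n
... | inj₂ refl = e

Continuous : (𝒫ω → 𝒫ω) → Set
Continuous f = ∀ x n → ∃ λ k → ∀ y → Agree k x y → Agree n (f x) (f y)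

id-continuous : Continuous id
id-continuous x n = n , λ _ → id

∘-continuous : ∀ {f g} → Continuous f → Continuous g → Continuous (f ∘ g)
∘-continuous {g = g} fc gc x n with fc (g x) n
... | m , hm with gc x m
... | k , hk = k , λ y → hm (g y) ∘ hk y

∩-continuous : ∀ X → Continuous (_∩ω X)
∩-continuous X x n = n , λ y h m m<n → cong (_∧ X m) (h m m<n)

Open-preimage : ∀ {U f} → Continuous f → Open U → Open (U ∘ f)
Open-preimage {f = f} fc op x x∈U with op (f x) x∈U
... | n , h with fc x n
... | k , hk = k , λ y → h (f y) ∘ hk y

Borel-preimage : ∀ {U f} → Continuous f → Borel U → Borel (U ∘ f)
Borel-preimage fc (open-set op)         = open-set (Open-preimage fc op)
Borel-preimage fc (complement b)        = complement (Borel-preimage fc b)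
Borel-preimage fc (union b)             = union (λ n → Borel-preimage fc (b n))
Borel-preimage fc (resp (U⊆V , V⊆U) b) = resp (U⊆V , V⊆U) (Borel-preimage fc b)

-- A stem of length `N` is given by a total real `a`, of which only the values below `N` count;
-- finite sequences need no type of their own.
glue : ℕ → 𝒫ω → 𝒫ω → 𝒫ω
glue N a B k = if below N k then a k else B k

glue-< : ∀ {N a B k} → k < N → glue N a B k ≡ a k
glue-< {a = a} {B} {k} p = cong (if_then a k else B k) (∈below⁺ p)

glue-≥ : ∀ {N a B k} → N ≤ k → glue N a B k ≡ B k
glue-≥ {a = a} {B} {k} p = cong (if_then a k else B k) (below-≡false p)

glue-continuous : ∀ N a → Continuous (glue N a)
glue-continuous N a x n = n , λ y h m m<n → cong (if below N m then a m else_) (h m m<n)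

-- Coding of pairs and search in subsets of ω

Bool-ext : ∀ {a b} → (a ≡ true → b ≡ true) → (b ≡ true → a ≡ true) → a ≡ b
Bool-ext {true}  {b}     h _ = sym (h refl)
Bool-ext {false} {true}  _ k = k refl
Bool-ext {false} {false} _ _ = refl

-- Cantor's enumeration along the antidiagonals.
unpair : ℕ → ℕ × ℕ
unpair zero    = 0 , 0
unpair (suc k) with unpair k
... | zero  , n = suc n , 0
... | suc m , n = m , suc n

-- Induction on the antidiagonal `d`, then on `n`: `(m , suc n)` comes right after `(suc m , n)`,
-- and `(suc m , 0)` right after `(0 , m)`, the last pair of the antidiagonal before.
unpair-surjective : ∀ m n → ∃ λ k → unpair k ≡ (m , n)
unpair-surjective m n = go (m + n) m n refl
  where
  go : ∀ d m n → m + n ≡ d → ∃ λ k → unpair k ≡ (m , n)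
  go d m (suc n) e with go d (suc m) n (trans (sym (+-suc m n)) e)
  ... | k , h = suc k , unpair-suc k h
    where
    unpair-suc : ∀ k → unpair k ≡ (suc m , n) → unpair (suc k) ≡ (m , suc n)
    unpair-suc k h rewrite h = refl
  go d zero zero e = 0 , refl
  go (suc d) (suc m) zero e with go d zero m (suc-injective (trans (cong suc (sym (+-identityʳ m))) e))
  ... | k , h = suc k , unpair-suc k h
    where
    unpair-suc : ∀ k → unpair k ≡ (zero , m) → unpair (suc k) ≡ (suc m , zero)
    unpair-suc k h rewrite h = refl

predecessor : ∀ (B : 𝒫ω) m → (∀ k → k < m → B k ≡ false) ⊎
  (∃ λ l → l < m × B l ≡ true × (∀ k → l < k → k < m → B k ≡ false))
predecessor B zero = inj₁ λ _ ()
predecessor B (suc m) with B m ≟ᵇ true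
... | yes m∈ = inj₂ (m , n<1+n m , m∈ , λ k m<k k<1+m → contradiction (m<1+n⇒m≤n k<1+m) (<⇒≱ m<k))
... | no m∉ with predecessor B m
...   | inj₁ gap = inj₁ λ k k<1+m → case m<1+n⇒m<n∨m≡n k<1+m of λ where
  (inj₁ k<m)  → gap k k<m
  (inj₂ refl) → ¬-not m∉
...   | inj₂ (l , l<m , l∈ , gap) = inj₂ (l , <-trans l<m (n<1+n m) , l∈ , λ k l<k k<1+m →
  case m<1+n⇒m<n∨m≡n k<1+m of λ where
    (inj₁ k<m)  → gap k l<k k<m
    (inj₂ refl) → ¬-not m∉)

abstract
  firstFrom : ∀ (B : 𝒫ω) N → (∃ λ n → N ≤ n × n ∈ El B) →
    ∃ λ n → N ≤ n × n ∈ El B × (∀ k → N ≤ k → k < n → B k ≡ false)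
  firstFrom B N (n , N≤n , n∈) = <-rec P search n N≤n n∈
    where
    P : ℕ → Set
    P n = N ≤ n → n ∈ El B → ∃ λ n → N ≤ n × n ∈ El B × (∀ k → N ≤ k → k < n → B k ≡ false)
    search : ∀ n → (∀ {m} → m < n → P m) → P n
    search n ih N≤n n∈ with predecessor B n
    ... | inj₁ gap = n , N≤n , n∈ , λ k _ → gap k
    ... | inj₂ (l , l<n , l∈ , gap) with <-≤-connex l N
    ...   | inj₁ l<N = n , N≤n , n∈ , λ k N≤k → gap k (<-≤-trans l<N N≤k)
    ...   | inj₂ N≤l = ih l<n N≤l l∈

does⁻ : {P : Set} (P? : Dec P) → does P? ≡ true → P
does⁻ (yes p) _ = p

-- Ideals and positive sets

module IdealProperties {I : Pred 𝒫ω 0ℓ} (isIdeal : IsIdeal I) where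
  open IsIdeal isIdeal public

  abstract
    -- Finite sets belong to the ideal, so an inclusion that may fail below `N` is as good as a full
    -- one.
    cover : ∀ N {A} B C → I B → I C →
      (∀ {n} → N ≤ n → n ∈ El A → n ∈ El B ⊎ n ∈ El C) → I A
    cover N {A} B C IB IC h = downward A ((B ∪ω C) ∪ω below N) sub
      (∪-closed _ _ (∪-closed B C IB IC) (finite _ (below-finite N)))
      where
      sub : El A ⊆ El ((B ∪ω C) ∪ω below N)
      sub {n} p with <-≤-connex n N
      ... | inj₁ n<N = ∈∪ʳ (B ∪ω C) (below N) (∈below⁺ n<N)
      ... | inj₂ N≤n with h N≤n p
      ...   | inj₁ q = ∈∪ˡ (B ∪ω C) (below N) (∈∪ˡ B C q)
      ...   | inj₂ q = ∈∪ˡ (B ∪ω C) (below N) (∈∪ʳ B C q)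

    small : ∀ {N A B} → A ⊆[ N ] B → I B → I A
    small {N} {A} {B} sub IB = cover N B B IB IB (λ N≤n p → inj₁ (sub N≤n p))

  ∅∈I : I (const false)
  ∅∈I = finite _ ([] , λ _ ())

  ⁺-mono : ∀ {A B} → El A ⊆ El B → A ∈ I ⁺ → B ∈ I ⁺
  ⁺-mono {A} {B} sub pos IB = pos (downward A B sub IB)

  abstract
    ⁺-∩ : ∀ {N} A B → B ⊆[ N ] A → B ∈ I ⁺ → (B ∩ω A) ∈ I ⁺
    ⁺-∩ A B sub pos IBA = pos (small (λ N≤n p → ∈∩⁺ B A p (sub N≤n p)) IBA)

    ⁺-∖ : ∀ A B → A ∈ I ⁺ → I B → (A ∖ω B) ∈ I ⁺
    ⁺-∖ A B pos IB IAB = pos (cover 0 (A ∖ω B) B IAB IB (λ {n} _ p → case B n ≟ᵇ true of λ where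
      (yes q) → inj₂ q
      (no ¬q) → inj₁ (∈∖⁺ A B p ¬q)))

  ⁺⇒Infinite : ∀ {A} → A ∈ I ⁺ → Infinite A
  ⁺⇒Infinite pos fin = pos (finite _ fin)

-- Comprehension and restrictions of ideals

module Classical (em : ExcludedMiddle (Level.suc 0ℓ)) (ext : Extensionality 0ℓ 0ℓ) where

  dec : (P : Set) → Dec P
  dec P = map′ lower lift (em {Lift _ P})

  abstract
    byContradiction : {P : Set} → ¬ ¬ P → P
    byContradiction {P} = decidable-stable (dec P)

  -- Comprehension: excluded middle turns a predicate on ω into a point of 2^ω.
  ⟦_⟧ : {A : Set} → Pred A 0ℓ → A → Bool
  ⟦ P ⟧ a = does (dec (P a))

  ⟦⟧⁺ : {A : Set} (P : Pred A 0ℓ) {a : A} → P a → ⟦ P ⟧ a ≡ true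
  ⟦⟧⁺ P {a} = dec-true (dec (P a))

  ⟦⟧⁻ : {A : Set} (P : Pred A 0ℓ) {a : A} → ⟦ P ⟧ a ≡ true → P a
  ⟦⟧⁻ P {a} = does⁻ (dec (P a))

  abstract
    Infinite⇒unbounded : ∀ {A} → Infinite A → ∀ N → ∃ λ n → N ≤ n × n ∈ El A
    Infinite⇒unbounded inf N = byContradiction λ h →
      inf (upTo N , λ n p → ∈-upTo⁺ (≰⇒> λ N≤n → h (n , N≤n , p)))

  record Good (I : Pred 𝒫ω 0ℓ) : Set₁ where
    field
      isIdeal : IsIdeal I
      tall    : Tall I
      borel   : Borel I
      ramsey  : Ramsey I
    open IdealProperties isIdeal public

  infix 8 _↾_

  -- Still an ideal on ω, in which the complement of `X` is small. Its quotient is the part of the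
  -- forcing below `X`, so (DW) becomes available below `X`.
  _↾_ : Pred 𝒫ω 0ℓ → 𝒫ω → Pred 𝒫ω 0ℓ
  (I ↾ X) A = I (A ∩ω X)

  abstract
    ↾-good : ∀ {I X} → Good I → X ∈ I ⁺ → Good (I ↾ X)
    ↾-good {I} {X} good X⁺ = record
      { isIdeal = record
        { downward = λ A B A⊆B → downward _ _
            (λ p → ∈∩⁺ B X (A⊆B (∈∩ˡ A X p)) (∈∩ʳ A X p))
        ; ∪-closed = λ A B IA IB → cover 0 (A ∩ω X) (B ∩ω X) IA IB (∪-cases A B)
        ; finite   = λ { A (xs , h) → finite _ (xs , λ n p → h n (∈∩ˡ A X p)) }
        ; proper   = X⁺
        }
      ; tall   = tall′
      ; borel  = Borel-preimage (∩-continuous X) borel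
      ; ramsey = ramsey′
      }
      where
      open Good good
      ∪-cases : ∀ A B {n} → 0 ≤ n → n ∈ El ((A ∪ω B) ∩ω X) → n ∈ El (A ∩ω X) ⊎ n ∈ El (B ∩ω X)
      ∪-cases A B {n} _ p with A n
      ... | true  = inj₁ p
      ... | false = inj₂ p

      tall′ : Tall (I ↾ X)
      tall′ A inf with dec (Finite (A ∩ω X))
      -- A set almost disjoint from `X` already belongs to the restriction.
      ... | yes fin = A , id , inf , finite _ fin
      ... | no inf′ with tall (A ∩ω X) inf′
      ...   | B , B⊆ , Binf , IB = B , ∈∩ˡ A X ∘ B⊆ , Binf , downward _ B (∈∩ˡ B X) IB

      ramsey′ : Ramsey (I ↾ X)
      ramsey′ Y Y⁺ c with ramsey (Y ∩ω X) Y⁺ c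
      ... | Z , Z⊆ , Z⁺ , hom = Z , ∈∩ˡ Y X ∘ Z⊆ ,
        ⁺-mono (λ p → ∈∩⁺ Z X p (∈∩ʳ Y X (Z⊆ p))) Z⁺ , hom

  -- Maximal antichains

  module MaximalAntichain {A : Set} (D : Pred A 0ℓ) (_#_ : A → A → Set)
    (#-sym : ∀ {a b} → a # b → b # a) (#-irrefl : ∀ {a} → D a → ¬ (a # a)) where

    infix 4 _⊑_

    _⊑_ : (A → Bool) → (A → Bool) → Set
    S ⊑ S′ = ∀ a → S a ≡ true → S′ a ≡ true

    ⊑-antisym : ∀ {S S′} → S ⊑ S′ → S′ ⊑ S → S ≡ S′
    ⊑-antisym {S} {S′} p q = ext λ a → Bool-ext (p a) (q a)

    Free : (A → Bool) → Pred A 0ℓ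
    Free S a = D a × (∀ s → S s ≡ true → a # s)

    insert : A → (A → Bool) → A → Bool
    insert a S = ⟦ (λ b → S b ≡ true ⊎ b ≡ a) ⟧

    -- The decision carries the free element itself, so excluded middle acts here as a choice
    -- function. It is an explicit argument so that later proofs can split on it.
    extendBy : ∀ S → Dec (∃ (Free S)) → A → Bool
    extendBy S (yes (a , _)) = insert a S
    extendBy S (no _)        = S

    extend : (A → Bool) → A → Bool
    extend S = extendBy S (dec (∃ (Free S)))

    ⊑-extend : ∀ S → S ⊑ extend S
    ⊑-extend S = go (dec (∃ (Free S)))
      where
      go : ∀ d → S ⊑ extendBy S d
      go (yes (a , _)) b p = ⟦⟧⁺ (λ b → S b ≡ true ⊎ b ≡ a) (inj₁ p)
      go (no _)        b p = p

    member-of : ((A → Bool) → Bool) → Pred A 0ℓ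
    member-of F a = ∃ λ S → F S ≡ true × S a ≡ true

    -- Zermelo's tower: closed under one-element extensions and arbitrary unions.
    data Tower : (A → Bool) → Set where
      step : ∀ {S} → Tower S → Tower (extend S)
      sup  : ∀ F → (∀ S → F S ≡ true → Tower S) → Tower ⟦ member-of F ⟧

    -- Nothing in the tower lies strictly between a member and its extension. `compare` recurses on
    -- the left tower and `compare-step` on the right one; when two members include each other,
    -- antisymmetry identifies them and their extensions.
    compare : ∀ {S S′} → Tower S → Tower S′ → S ⊑ S′ ⊎ extend S′ ⊑ S
    compare-step : ∀ {S S′} → Tower S → Tower S′ → extend S ⊑ S′ ⊎ S′ ⊑ S

    compare {S′ = S′} (sup F h) t′ with dec (∃ λ S → F S ≡ true × extend S′ ⊑ S)
    ... | yes (S , FS , p) = inj₂ λ a q → ⟦⟧⁺ (member-of F) (S , FS , p a q)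
    ... | no ¬p = inj₁ λ a q → let (S , FS , Sa) = ⟦⟧⁻ (member-of F) q in
      case compare (h S FS) t′ of λ where
        (inj₁ S⊑S′) → S⊑S′ a Sa
        (inj₂ p)    → contradiction (S , FS , p) ¬p
    compare {S′ = S′} (step {S} t) t′ with compare-step t t′
    ... | inj₁ p = inj₁ p
    ... | inj₂ S′⊑S with compare t t′
    ...   | inj₂ p = inj₂ λ a q → ⊑-extend S a (p a q)
    ...   | inj₁ S⊑S′ with ⊑-antisym S⊑S′ S′⊑S
    ...     | refl = inj₂ λ _ → id

    compare-step {S} t (sup F h) with dec (∃ λ S′ → F S′ ≡ true × extend S ⊑ S′)
    ... | yes (S′ , FS′ , p) = inj₁ λ a q → ⟦⟧⁺ (member-of F) (S′ , FS′ , p a q)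
    ... | no ¬p = inj₂ λ a q → let (S′ , FS′ , S′a) = ⟦⟧⁻ (member-of F) q in
      case compare-step t (h S′ FS′) of λ where
        (inj₁ p)    → contradiction (S′ , FS′ , p) ¬p
        (inj₂ S′⊑S) → S′⊑S a S′a
    compare-step {S} t (step {S′} t′) with compare-step t t′
    ... | inj₁ p = inj₁ λ a q → ⊑-extend S′ a (p a q)
    ... | inj₂ S′⊑S with compare t t′
    ...   | inj₂ p = inj₂ p
    ...   | inj₁ S⊑S′ with ⊑-antisym S⊑S′ S′⊑S
    ...     | refl = inj₁ λ _ → id

    Antichain : (A → Bool) → Set
    Antichain S = (∀ a → S a ≡ true → D a) ×
                  (∀ a b → S a ≡ true → S b ≡ true → a ≡ b ⊎ a # b)

    -- For a union, two elements come from two members of the tower; these are comparable, so both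
    -- elements lie in the larger one, which is an antichain by induction.
    Tower⇒Antichain : ∀ {S} → Tower S → Antichain S
    Tower⇒Antichain (step {S} t) = go (dec (∃ (Free S)))
      where
      go : ∀ d → Antichain (extendBy S d)
      go (no _) = Tower⇒Antichain t
      go (yes (c , Dc , c#)) with Tower⇒Antichain t
      ... | SD , S# = insert-D , insert-#
        where
        view : ∀ a → insert c S a ≡ true → S a ≡ true ⊎ a ≡ c
        view a = ⟦⟧⁻ (λ b → S b ≡ true ⊎ b ≡ c)
        insert-D : ∀ a → insert c S a ≡ true → D a
        insert-D a p with view a p
        ... | inj₁ Sa   = SD a Sa
        ... | inj₂ refl = Dc
        insert-# : ∀ a b → insert c S a ≡ true → insert c S b ≡ true → a ≡ b ⊎ a # b
        insert-# a b p q with view a p | view b q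
        ... | inj₁ Sa   | inj₁ Sb   = S# a b Sa Sb
        ... | inj₁ Sa   | inj₂ refl = inj₂ (#-sym (c# a Sa))
        ... | inj₂ refl | inj₁ Sb   = inj₂ (c# b Sb)
        ... | inj₂ refl | inj₂ refl = inj₁ refl
    Tower⇒Antichain (sup F h) =
      (λ a p → let (S , FS , Sa) = ⟦⟧⁻ (member-of F) p in
        proj₁ (Tower⇒Antichain (h S FS)) a Sa) ,
      λ a b p q → let (S , FS , Sa) = ⟦⟧⁻ (member-of F) p
                      (S′ , FS′ , S′b) = ⟦⟧⁻ (member-of F) q in
        case compare (h S FS) (h S′ FS′) of λ where
          (inj₁ S⊑S′) → proj₂ (Tower⇒Antichain (h S′ FS′)) a b (S⊑S′ a Sa) S′b
          (inj₂ S′⊑S) → proj₂ (Tower⇒Antichain (h S FS)) a b Sa (S′⊑S b (⊑-extend S′ b S′b))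

    top : A → Bool
    top = ⟦ member-of ⟦ Tower ⟧ ⟧

    top-tower : Tower top
    top-tower = sup ⟦ Tower ⟧ λ S → ⟦⟧⁻ Tower

    top-antichain : Antichain top
    top-antichain = Tower⇒Antichain top-tower

    -- The extension of `top` is in the tower and hence below `top`. An element added by it would
    -- already be in `top` and thus be incompatible with itself.
    top-maximal : ∀ a → D a → ∃ λ b → top b ≡ true × ¬ (a # b)
    top-maximal a Da = byContradiction λ none →
      no-free (dec (∃ (Free top))) extend-top⊑top
        (a , Da , λ b p → byContradiction λ ¬# → none (b , p , ¬#))
      where
      extend-top⊑top : extend top ⊑ top
      extend-top⊑top b p =
        ⟦⟧⁺ (member-of ⟦ Tower ⟧) (extend top , ⟦⟧⁺ Tower (step top-tower) , p)
      no-free : ∀ d → extendBy top d ⊑ top → ¬ ∃ (Free top)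
      no-free (yes (c , Dc , c#)) sub _ =
        #-irrefl Dc (c# c (sub c (⟦⟧⁺ (λ b → top b ≡ true ⊎ b ≡ c) (inj₂ refl))))
      no-free (no ¬free) _ = ¬free

  -- Names for reals

  module ForcingProperties {I : Pred 𝒫ω 0ℓ} (isIdeal : IsIdeal I) where
    open IdealProperties isIdeal
    open Forcing I hiding (AddsReal; Name; IsNewRealName; CountableWidthBelow)

    ⊆⇒≼ : ∀ {p q} → El (proj₁ p) ⊆ El (proj₁ q) → p ≼ q
    ⊆⇒≼ {p , _} {q , _} sub = downward (p ∖ω q) _
      (λ h → contradiction (sub (∈∖ˡ p q h)) (∈∖ʳ p q h)) ∅∈I

    ≼-trans : ∀ {p q r} → p ≼ q → q ≼ r → p ≼ r
    ≼-trans {p , _} {q , _} {r , _} pq qr = cover 0 (p ∖ω q) (q ∖ω r) pq qr λ {n} _ h →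
      case q n ≟ᵇ true of λ where
        (yes nq) → inj₂ (∈∖⁺ q r nq (∈∖ʳ p r h))
        (no ¬nq) → inj₁ (∈∖⁺ p q (∈∖ˡ p r h) ¬nq)

    meet : (p q : ℚ) → ¬ (p ⊥ q) → ℚ
    meet (p , _) (q , _) pos = p ∩ω q , pos

    meet-≼ˡ : ∀ p q pos → meet p q pos ≼ p
    meet-≼ˡ p q pos = ⊆⇒≼ {meet p q pos} {p} (∈∩ˡ (proj₁ p) (proj₁ q))

    meet-≼ʳ : ∀ p q pos → meet p q pos ≼ q
    meet-≼ʳ p q pos = ⊆⇒≼ {meet p q pos} {q} (∈∩ʳ (proj₁ p) (proj₁ q))

    ≼⇒compatible : ∀ {r p q} → r ≼ p → r ≼ q → ¬ (p ⊥ q)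
    ≼⇒compatible {r , r⁺} {p , _} {q , _} rp rq pq =
      ⁺-∖ (r ∖ω (p ∩ω q)) (r ∖ω p) (⁺-∖ r (p ∩ω q) r⁺ pq) rp
        (downward _ _ (λ h → let h′ = ∈∖ˡ (r ∖ω (p ∩ω q)) (r ∖ω p) h
                                 hr = ∈∖ˡ r (p ∩ω q) h′ in
          ∈∖⁺ r q hr λ nq → ∈∖ʳ (r ∖ω (p ∩ω q)) (r ∖ω p) h
            (∈∖⁺ r p hr λ np → ∈∖ʳ r (p ∩ω q) h′ (∈∩⁺ p q np nq))) rq)

    ⊩-mono : ∀ {p q} τ n b → q ≼ p → p ⊩ τ ⟨ n ⟩≈ b → q ⊩ τ ⟨ n ⟩≈ b
    ⊩-mono {p} {q} τ n b qp h r rq = h r (≼-trans {r} {q} {p} rq qp)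

    ⊩-unique : ∀ {τ} → IsRealName τ → ∀ p n {a b} → p ⊩ τ ⟨ n ⟩≈ a → p ⊩ τ ⟨ n ⟩≈ b → a ≡ b
    ⊩-unique real p n {true}  {true}  _ _ = refl
    ⊩-unique real p n {false} {false} _ _ = refl
    ⊩-unique real p n {true}  {false} h k = contradiction (h , k) (IsRealName.single-value real p n)
    ⊩-unique real p n {false} {true}  h k = contradiction (k , h) (IsRealName.single-value real p n)

  -- A new real from a failure of distributivity

  module NewReal {I : Pred 𝒫ω 0ℓ} (isIdeal : IsIdeal I) (D : ℕ → Pred 𝒫ω 0ℓ)
    (dense : ∀ m Y → Y ∈ I ⁺ → ∃ λ Z → El Z ⊆ El Y × Z ∈ I ⁺ × D m Z)
    (¬distributive : ¬ (∃ λ Q → Q ∈ I ⁺ × ∃ λ (A : ℕ → 𝒫ω) → ∀ m → D m (A m) × I (Q ∖ω A m)))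
    where
    open IdealProperties isIdeal
    open ForcingProperties isIdeal
    open Forcing I hiding (AddsReal; Name; IsNewRealName; CountableWidthBelow)

    ∩-comm-I : ∀ {A B} → I (A ∩ω B) → I (B ∩ω A)
    ∩-comm-I {A} {B} = downward _ _ λ h → ∈∩⁺ A B (∈∩ʳ B A h) (∈∩ˡ B A h)

    ∩-irrefl : ∀ {A} → A ∈ I ⁺ → ¬ I (A ∩ω A)
    ∩-irrefl {A} A⁺ = A⁺ ∘ downward _ _ λ h → ∈∩⁺ A A h h

    module MA m = MaximalAntichain (λ A → D m A × A ∈ I ⁺) (λ A B → I (A ∩ω B))
      (λ {A} {B} → ∩-comm-I {A} {B}) (λ {A} DA → ∩-irrefl {A} (proj₂ DA))

    𝒜 : ℕ → Pred 𝒫ω 0ℓ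
    𝒜 m A = MA.top m A ≡ true

    𝒜⇒⁺ : ∀ m {A} → 𝒜 m A → A ∈ I ⁺
    𝒜⇒⁺ m {A} h = proj₂ (proj₁ (MA.top-antichain m) A h)

    𝒜-unique : ∀ m {A B} → 𝒜 m A → 𝒜 m B → ¬ I (A ∩ω B) → A ≡ B
    𝒜-unique m {A} {B} h k pos with proj₂ (MA.top-antichain m) A B h k
    ... | inj₁ e = e
    ... | inj₂ ⊥AB = contradiction ⊥AB pos

    𝒜-predense : ∀ m A → A ∈ I ⁺ → ∃ λ B → 𝒜 m B × (A ∩ω B) ∈ I ⁺
    𝒜-predense m A A⁺ with dense m A A⁺
    ... | Z , Z⊆A , Z⁺ , DZ with MA.top-maximal m Z (DZ , Z⁺)
    ...   | B , B∈ , pos = B , B∈ , ⁺-mono (λ h → ∈∩⁺ A B (Z⊆A (∈∩ˡ Z B h)) (∈∩ʳ Z B h)) pos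

    -- τ codes the sequence of the unique elements of 𝒜 m in the generic ultrafilter.
    τ : Name I
    τ k b (p , _) = 𝒜 (proj₁ (unpair k)) p × p (proj₂ (unpair k)) ≡ b

    -- Predensity of `𝒜 m` makes the name total. It is single-valued because two elements of `𝒜 m`
    -- above a common condition are compatible and therefore equal.
    τ-real : IsRealName τ
    τ-real .IsRealName.total p k q q≼p with 𝒜-predense (proj₁ (unpair k)) (proj₁ q) (proj₂ q)
    ... | s , s∈ , pos = meet q s′ pos , meet-≼ˡ q s′ pos ,
        _ , λ r r≼ → r , ⊆⇒≼ {r} {r} id , s′ , (s∈ , refl) ,
          ≼-trans {r} {meet q s′ pos} {s′} r≼ (meet-≼ʳ q s′ pos)
      where
      s′ : ℚ
      s′ = s , 𝒜⇒⁺ _ s∈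
    τ-real .IsRealName.single-value p k (h , h′) with h p (⊆⇒≼ {p} {p} id)
    ... | r , r≼p , s , (s∈ , st) , r≼s with h′ r r≼p
    ...   | r′ , r′≼r , s′ , (s′∈ , s′f) , r′≼s′
      with 𝒜-unique _ s∈ s′∈
             (≼⇒compatible {r′} {s} {s′} (≼-trans {r′} {r} {s} r′≼r r≼s) r′≼s′)
    ...     | refl with trans (sym st) s′f
    ...       | ()

    -- If `q` forced the name to be `x`, then `x` would decode to sets `A m` in `D m` that contain
    -- `q` modulo `I`, against the failure of distributivity.
    τ-new : IsNewRealName I τ
    τ-new .IsNewRealName.isRealName = τ-real
    τ-new .IsNewRealName.new p x q q≼p q⊩x = ¬distributive (proj₁ q , proj₂ q , A , λ m → D-A m , ≼A m)
      where
      A : ℕ → 𝒫ω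
      A m n = x (proj₁ (unpair-surjective m n))

      compatible⇒≡ : ∀ m {s} → 𝒜 m s → ¬ I (proj₁ q ∩ω s) → s ≡ A m
      compatible⇒≡ m {s} s∈ pos = ext λ n →
        let s′ = s , 𝒜⇒⁺ m s∈
            (k , e) = unpair-surjective m n
            (r , r≼ , t , t∈ , r≼t) = q⊩x k (meet q s′ pos) (meet-≼ˡ q s′ pos)
            (t∈′ , tn) = subst (λ mn → 𝒜 (proj₁ mn) (proj₁ t) × proj₁ t (proj₂ mn) ≡ x k) e t∈
            s≡t = 𝒜-unique m s∈ t∈′
              (≼⇒compatible {r} {s′} {t} (≼-trans {r} {meet q s′ pos} {s′} r≼ (meet-≼ʳ q s′ pos)) r≼t)
        in trans (cong (λ S → S n) s≡t) tn

      D-A : ∀ m → D m (A m)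
      D-A m with 𝒜-predense m (proj₁ q) (proj₂ q)
      ... | s , s∈ , pos =
        subst (D m) (compatible⇒≡ m s∈ pos) (proj₁ (proj₁ (MA.top-antichain m) s s∈))

      -- A positive remainder would meet an element of `𝒜 m` positively; that element is compatible
      -- with `q`, hence it is `A m`, which is disjoint from the remainder.
      ≼A : ∀ m → I (proj₁ q ∖ω A m)
      ≼A m = byContradiction λ rest⁺ →
        let Q = proj₁ q
            (s , s∈ , pos) = 𝒜-predense m (Q ∖ω A m) rest⁺
            pos′ : (Q ∩ω s) ∈ I ⁺
            pos′ = ⁺-mono (λ h → ∈∩⁺ Q s (∈∖ˡ Q (A m) (∈∩ˡ (Q ∖ω A m) s h)) (∈∩ʳ (Q ∖ω A m) s h)) pos
            s⊆A = subst (λ S → El s ⊆ El S) (compatible⇒≡ m s∈ pos′) id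
        in pos (downward _ _ (λ h → ⊥-elim (∈∖ʳ Q (A m) (∈∩ˡ (Q ∖ω A m) s h)
                 (s⊆A (∈∩ʳ (Q ∖ω A m) s h)))) ∅∈I)

  -- Separation of countable families modulo the ideal

  module _ {I : Pred 𝒫ω 0ℓ} (isIdeal : IsIdeal I) where
    open IdealProperties isIdeal

    initial-∪ : (ℕ → 𝒫ω) → ℕ → 𝒫ω
    initial-∪ T j = ⟦ (λ k → ∃ λ i → i < j × k ∈ El (T i)) ⟧

    ∈initial-∪⁺ : ∀ T {i j k} → i < j → k ∈ El (T i) → k ∈ El (initial-∪ T j)
    ∈initial-∪⁺ T {i} {j} i<j p = ⟦⟧⁺ (λ k → ∃ λ i → i < j × k ∈ El (T i)) (i , i<j , p)

    initial-∪-small : ∀ T → (∀ i → I (T i)) → ∀ j → I (initial-∪ T j)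
    initial-∪-small T IT zero = downward _ _
      (λ p → case ⟦⟧⁻ (λ k → ∃ λ i → i < 0 × k ∈ El (T i)) p of λ where (_ , () , _)) ∅∈I
    initial-∪-small T IT (suc j) = cover 0 (initial-∪ T j) (T j) (initial-∪-small T IT j) (IT j) split
      where
      split : ∀ {n} → 0 ≤ n → n ∈ El (initial-∪ T (suc j)) → n ∈ El (initial-∪ T j) ⊎ n ∈ El (T j)
      split _ p with ⟦⟧⁻ (λ k → ∃ λ i → i < suc j × k ∈ El (T i)) p
      ... | i , i<1+j , q with m<1+n⇒m<n∨m≡n i<1+j
      ...   | inj₁ i<j  = inj₁ (∈initial-∪⁺ T i<j q)
      ...   | inj₂ refl = inj₂ q

    -- A point enters `G` if some `P i` contains it and no `N j` with `j < i` does. The errors at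
    -- `j` are then covered by finitely many intersections `P i ∩ω N j` or `P j ∩ω N i`, all in `I`.
    separate : (P N : ℕ → 𝒫ω) → (∀ i j → I (P i ∩ω N j)) →
      ∃ λ G → (∀ j → I (P j ∖ω G)) × (∀ j → I (N j ∩ω G))
    separate P N IPN = ⟦ InG ⟧ , outside , inside
      where
      InG : Pred ℕ 0ℓ
      InG k = ∃ λ i → k ∈ El (P i) × (∀ j → j < i → ¬ (k ∈ El (N j)))

      outside : ∀ j → I (P j ∖ω ⟦ InG ⟧)
      outside j = downward _ _ sub (initial-∪-small common (IPN j) j)
        where
        common : ℕ → 𝒫ω
        common i = P j ∩ω N i
        sub : El (P j ∖ω ⟦ InG ⟧) ⊆ El (initial-∪ common j)
        sub {k} h = byContradiction λ ¬h → ∈∖ʳ (P j) ⟦ InG ⟧ h (⟦⟧⁺ InG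
          (j , ∈∖ˡ (P j) ⟦ InG ⟧ h , λ i i<j Ni →
            ¬h (∈initial-∪⁺ common i<j (∈∩⁺ (P j) (N i) (∈∖ˡ (P j) ⟦ InG ⟧ h) Ni))))

      inside : ∀ j → I (N j ∩ω ⟦ InG ⟧)
      inside j = downward _ _ sub (initial-∪-small common (λ i → IPN i j) (suc j))
        where
        common : ℕ → 𝒫ω
        common i = P i ∩ω N j
        sub : El (N j ∩ω ⟦ InG ⟧) ⊆ El (initial-∪ common (suc j))
        sub {k} h with ⟦⟧⁻ InG (∈∩ʳ (N j) ⟦ InG ⟧ h)
        ... | i , Pi , least = ∈initial-∪⁺ common (≰⇒> λ j<i → least j j<i Nj) (∈∩⁺ (P i) (N j) Pi Nj)
          where
          Nj : k ∈ El (N j)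
          Nj = ∈∩ˡ (N j) ⟦ InG ⟧ h

  -- The lexicographic order, with `false` below `true`

  LexLe : 𝒫ω → 𝒫ω → Set
  LexLe x y = ∀ n → Agree n x y → x n ≡ true → y n ≡ true

  lexColour : (ℕ → 𝒫ω) → ℕ → ℕ → Bool
  lexColour r m k = ⟦ (λ mk → LexLe (r (proj₁ mk)) (r (proj₂ mk))) ⟧ (m , k)

  -- A sequence of reals that is lexicographically monotone on Y, increasing or
  -- decreasing, converges coordinate by coordinate along Y.
  module LexLimit (r : ℕ → 𝒫ω) (Y : 𝒫ω) (hom : HomogeneousFor (lexColour r) Y) where

    StableFrom : ℕ → ℕ → Set
    StableFrom N n = ∀ k k′ → N ≤ k → N ≤ k′ → k ∈ El Y → k′ ∈ El Y → Agree n (r k) (r k′)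

    LimitAt : ℕ → ℕ → Bool → Set
    LimitAt N n b = ∀ k → N ≤ k → k ∈ El Y → r k n ≡ b

    -- The value `v` is absorbing: either it occurs and persists from then on, or it never occurs
    -- from `N` on and the value is always `not v`.
    settle : ∀ N n v →
      (∀ m k → N ≤ m → m < k → m ∈ El Y → k ∈ El Y → r m n ≡ v → r k n ≡ v) →
      ∃ λ N′ → N ≤ N′ × ∃ (LimitAt N′ n)
    settle N n v mono with dec (∃ λ m → N ≤ m × m ∈ El Y × r m n ≡ v)
    ... | yes (m , N≤m , m∈ , e) =
      suc m , ≤-trans N≤m (n≤1+n m) , v , λ k m<k k∈ → mono m k N≤m m<k m∈ k∈ e
    ... | no none =
      N , ≤-refl , not v , λ k N≤k k∈ → ¬-not λ e → none (k , N≤k , k∈ , e)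

    -- Where the coordinates below `n` have stabilised, coordinate `n` is monotone along `Y`: colour
    -- `true` makes `true` absorbing. Under colour `false` a change from `false` to `true` would put
    -- `r m` lexicographically below `r k`, so `false` is absorbing.
    limit-step : ∀ N n → StableFrom N n → ∃ λ N′ → N ≤ N′ × ∃ (LimitAt N′ n)
    limit-step N n stable = go hom
      where
      Le : Pred (ℕ × ℕ) 0ℓ
      Le mk = LexLe (r (proj₁ mk)) (r (proj₂ mk))

      go : HomogeneousFor (lexColour r) Y → ∃ λ N′ → N ≤ N′ × ∃ (LimitAt N′ n)
      go (true , h) = settle N n true λ m k N≤m m<k m∈ k∈ →
        ⟦⟧⁻ Le (h m k m∈ k∈ m<k) n (stable m k N≤m (≤-trans N≤m (<⇒≤ m<k)) m∈ k∈)
      go (false , h) = settle N n false λ m k N≤m m<k m∈ k∈ rmn → ¬-not λ rkn →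
        let agree = stable m k N≤m (≤-trans N≤m (<⇒≤ m<k)) m∈ k∈
        in not-¬ (h m k m∈ k∈ m<k) (⟦⟧⁺ Le {m , k} λ j agree-j rmj →
          case <-cmp j n of λ where
            (tri< j<n _ _) → trans (sym (agree j j<n)) rmj
            (tri≈ _ refl _) → rkn
            (tri> _ _ n<j) → contradiction (trans (sym rkn) (trans (sym (agree-j n n<j)) rmn)) λ ())

    stable : ∀ n → ∃ λ N → StableFrom N n
    stable zero = 0 , λ _ _ _ _ _ _ _ ()
    stable (suc n) with stable n
    ... | N , st with limit-step N n st
    ...   | N′ , N≤N′ , b , lim = N′ , λ k k′ N′≤k N′≤k′ k∈ k′∈ →
      Agree-suc (st k k′ (≤-trans N≤N′ N′≤k) (≤-trans N≤N′ N′≤k′) k∈ k′∈)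
                (trans (lim k N′≤k k∈) (sym (lim k′ N′≤k′ k′∈)))

    limit : ∀ n → ∃ λ N → ∃ (LimitAt N n)
    limit n with stable n
    ... | N , st with limit-step N n st
    ...   | N′ , _ , lim = N′ , lim

  -- Countable width contradicts the Ramsey property

  module CountableWidth {I : Pred 𝒫ω 0ℓ} (isIdeal : IsIdeal I) (ramsey : Ramsey I)
    {τ : Name I} (isNew : IsNewRealName I τ) {X : 𝒫ω} (X⁺ : X ∈ I ⁺)
    (width : CountableWidthBelow I τ X) where
    open IdealProperties isIdeal
    open ForcingProperties isIdeal
    open Forcing I hiding (AddsReal; Name; IsNewRealName; CountableWidthBelow)
    open CountableWidthBelow width
    open IsNewRealName isNew

    -- Level `suc n` is taken because its elements decide the first `suc n` values, among them the
    -- value at `n`.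
    e : ℕ → ℕ → ℚ
    e n = proj₁ (countable (suc n))

    -- The enumeration may also list conditions outside the antichain, so a condition contributes
    -- only if it does force the value `b`.
    Part : ℕ → Bool → ℕ → Pred ℕ 0ℓ
    Part n b i k = k ∈ El (proj₁ (e n i)) × e n i ⊩ τ ⟨ n ⟩≈ b

    part : ℕ → Bool → ℕ → 𝒫ω
    part n b i = ⟦ Part n b i ⟧

    parts-disjoint : ∀ n i j → I (part n true i ∩ω part n false j)
    parts-disjoint n i j = byContradiction λ pos →
      let P = part n true i
          N = part n false j
          c = P ∩ω N , pos
          (k , _ , k∈) = Infinite⇒unbounded (⁺⇒Infinite pos) 0
          inP : ∀ {k} → k ∈ El (P ∩ω N) → Part n true i k
          inP h = ⟦⟧⁻ (Part n true i) (∈∩ˡ P N h)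
          inN : ∀ {k} → k ∈ El (P ∩ω N) → Part n false j k
          inN h = ⟦⟧⁻ (Part n false j) (∈∩ʳ P N h)
      in contradiction
        (⊩-unique isRealName c n
          (⊩-mono {e n i} {c} τ n true (⊆⇒≼ {c} {e n i} (proj₁ ∘ inP)) (proj₂ (inP k∈)))
          (⊩-mono {e n j} {c} τ n false (⊆⇒≼ {c} {e n j} (proj₁ ∘ inN)) (proj₂ (inN k∈))))
        λ ()

    G : ∀ n → ∃ λ G → (∀ j → I (part n true j ∖ω G)) × (∀ j → I (part n false j ∩ω G))
    G n = separate isIdeal (part n true) (part n false) (parts-disjoint n)

    r : ℕ → 𝒫ω
    r k n = proj₁ (G n) k

    exceptional : ℕ → Bool → ℕ → 𝒫ω
    exceptional n true  j = part n true j ∖ω proj₁ (G n)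
    exceptional n false j = part n false j ∩ω proj₁ (G n)

    exceptional-small : ∀ n b j → I (exceptional n b j)
    exceptional-small n true  = proj₁ (proj₂ (G n))
    exceptional-small n false = proj₂ (proj₂ (G n))

    ∈exceptional : ∀ n b j {k} → k ∈ El (part n b j) → ¬ (r k n ≡ b) → k ∈ El (exceptional n b j)
    ∈exceptional n true  j p ¬q = ∈∖⁺ (part n true j) (proj₁ (G n)) p ¬q
    ∈exceptional n false j p ¬q = ∈∩⁺ (part n false j) (proj₁ (G n)) p (¬-not ¬q)

    decide : ∀ n p → p ∈ 𝒜 (suc n) → ∃ λ b → p ⊩ τ ⟨ n ⟩≈ b
    decide n p p∈ with deciding (suc n) p p∈
    ... | s , h = _ , subst (λ m → p ⊩ τ ⟨ m ⟩≈ lookup s (fromℕ n)) (toℕ-fromℕ n) (h (fromℕ n))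

    compatible-below : ∀ {Y} (Y⁺ : Y ∈ I ⁺) → El Y ⊆ El X → ∀ q p → q ≼ (Y , Y⁺) →
      ¬ (q ⊥ p) → (proj₁ p ∩ω X) ∈ I ⁺
    compatible-below {Y} Y⁺ Y⊆X (Q , _) (P , _) q≼Y pos IPX =
      pos (cover 0 (Q ∖ω Y) (P ∩ω X) q≼Y IPX λ {k} _ h →
        case Y k ≟ᵇ true of λ where
          (yes k∈Y) → inj₂ (∈∩⁺ P X (∈∩ʳ Q P h) (Y⊆X k∈Y))
          (no k∉Y)  → inj₁ (∈∖⁺ Q Y (∈∩ˡ Q P h) k∉Y))

    -- Below `q` some `q′` decides the value at `n` and meets some `p` of the antichain positively;
    -- `p` meets `X` positively and so occurs in the enumeration. If `p` forced a value other than
    -- `b`, almost all of `Q′ ∩ω P` within `Y` would be exceptional, so `Q′ ∩ω P` would be in `I`.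
    limit-forced : ∀ {Y} (Y⁺ : Y ∈ I ⁺) → El Y ⊆ El X → ∀ N n b →
      (∀ k → N ≤ k → k ∈ El Y → r k n ≡ b) → (Y , Y⁺) ⊩ τ ⟨ n ⟩≈ b
    limit-forced {Y} Y⁺ Y⊆X N n b lim q q≼Y
      with IsRealName.total isRealName q n q (⊆⇒≼ {q} {q} id)
    ... | q′ , q′≼q , i , q′⊩ with IsMaximalAntichain.maximal (maximal (suc n)) q′
    ...   | p , p∈ , pos with decide n p p∈ | proj₂ (countable (suc n)) p
    ...     | b′ , p⊩ | find with find
          (p∈ , compatible-below Y⁺ Y⊆X q′ p (≼-trans {q′} {q} {Y , Y⁺} q′≼q q≼Y) pos)
    ...       | j , ej≗p = conclude (b ≟ᵇ b′)
      where
      Q′ = proj₁ q′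
      P = proj₁ p
      c : ℚ
      c = meet q′ p pos
      i≡b′ : i ≡ b′
      i≡b′ = ⊩-unique isRealName c n
        (⊩-mono {q′} {c} τ n i (meet-≼ˡ q′ p pos) q′⊩)
        (⊩-mono {p} {c} τ n b′ (meet-≼ʳ q′ p pos) p⊩)
      ej⊩ : e n j ⊩ τ ⟨ n ⟩≈ b′
      ej⊩ = ⊩-mono {p} {e n j} τ n b′ (⊆⇒≼ {e n j} {p} (λ {k} h → trans (sym (ej≗p k)) h)) p⊩

      conclude : Dec (b ≡ b′) → ∃ λ t → t ≼ q × (∃ λ s → s ∈ τ n b × t ≼ s)
      conclude (yes refl) with subst (λ a → q′ ⊩ τ ⟨ n ⟩≈ a) i≡b′ q′⊩ q′ (⊆⇒≼ {q′} {q′} id)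
      ... | t , t≼q′ , s , s∈ , t≼s = t , ≼-trans {t} {q′} {q} t≼q′ q′≼q , s , s∈ , t≼s
      conclude (no b≢b′) = contradiction
        (cover N (Q′ ∖ω Y) (exceptional n b′ j)
          (≼-trans {q′} {q} {Y , Y⁺} q′≼q q≼Y) (exceptional-small n b′ j) λ {k} N≤k h →
          case Y k ≟ᵇ true of λ where
            (yes k∈Y) → inj₂ (∈exceptional n b′ j
              (⟦⟧⁺ (Part n b′ j) (trans (ej≗p k) (∈∩ʳ Q′ P h) , ej⊩))
              λ rkn → b≢b′ (trans (sym (lim k N≤k k∈Y)) rkn))
            (no k∉Y) → inj₁ (∈∖⁺ Q′ Y (∈∩ˡ Q′ P h) k∉Y))
        pos

    absurd : Absurdity
    absurd with ramsey X X⁺ (lexColour r)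
    -- The coordinatewise limit `x` along `Y` is a ground model real, and `Y` forces the name to
    -- equal it.
    ... | Y , Y⊆X , Y⁺ , hom = new (Y , Y⁺) x (Y , Y⁺) (⊆⇒≼ {Y , Y⁺} {Y , Y⁺} id) λ n →
        limit-forced Y⁺ Y⊆X (proj₁ (limit n)) n (x n) (proj₂ (proj₂ (limit n)))
      where
      open LexLimit r Y hom
      x : 𝒫ω
      x n = proj₁ (proj₂ (limit n))

  -- Selectivity and the Ramsey property of Borel sets

  DenseBelow⁺ : Pred 𝒫ω 0ℓ → 𝒫ω → Pred 𝒫ω 0ℓ → Set
  DenseBelow⁺ I X D = ∀ Y → Y ∈ I ⁺ → El Y ⊆ El X → ∃ λ Z → El Z ⊆ El Y × Z ∈ I ⁺ × D Z

  Hereditary : Pred 𝒫ω 0ℓ → Set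
  Hereditary D = ∀ {A B} → El B ⊆ El A → D A → D B

  cons : Bool → 𝒫ω → 𝒫ω
  cons b a zero    = b
  cons b a (suc n) = a n

  cons-Agree : ∀ {N a a′} b → Agree N a a′ → Agree (suc N) (cons b a) (cons b a′)
  cons-Agree b h zero    _         = refl
  cons-Agree b h (suc m) (s≤s m<N) = h m m<N

  module _ {I : Pred 𝒫ω 0ℓ} {X : 𝒫ω} where

    abstract
      -- By locality only the 2^N stems of length `N` matter. They are treated one after another,
      -- splitting on the first bit; heredity preserves what has been achieved.
      dense-∀stems : ∀ N (D : 𝒫ω → Pred 𝒫ω 0ℓ) → (∀ a → Hereditary (D a)) →
        (∀ {a a′ A} → Agree N a a′ → D a A → D a′ A) →
        (∀ a → DenseBelow⁺ I X (D a)) → DenseBelow⁺ I X (λ A → ∀ a → D a A)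
      dense-∀stems zero D hered local dense Y Y⁺ Y⊆X with dense (const false) Y Y⁺ Y⊆X
      ... | Z , Z⊆Y , Z⁺ , DZ = Z , Z⊆Y , Z⁺ , λ a → local (λ _ ()) DZ
      dense-∀stems (suc N) D hered local dense Y Y⁺ Y⊆X
        with dense-∀stems N (D ∘ cons true) (hered ∘ cons true) (local ∘ cons-Agree true)
               (dense ∘ cons true) Y Y⁺ Y⊆X
      ... | Z , Z⊆Y , Z⁺ , DZ
        with dense-∀stems N (D ∘ cons false) (hered ∘ cons false) (local ∘ cons-Agree false)
               (dense ∘ cons false) Z Z⁺ (Y⊆X ∘ Z⊆Y)
      ...   | W , W⊆Z , W⁺ , DW = W , Z⊆Y ∘ W⊆Z , W⁺ , λ a → local (uncons a) (head (a 0) (a ∘ suc))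
        where
        head : ∀ b a → D (cons b a) W
        head true  a = hered (cons true a) W⊆Z (DZ a)
        head false a = DW a
        uncons : ∀ a → Agree (suc N) (cons (a 0) (a ∘ suc)) a
        uncons a zero    _ = refl
        uncons a (suc m) _ = refl

    abstract
      dense-∀< : (D : ℕ → Pred 𝒫ω 0ℓ) → (∀ n → Hereditary (D n)) →
        (∀ n → DenseBelow⁺ I X (D n)) → ∀ m → DenseBelow⁺ I X (λ A → ∀ n → n < m → D n A)
      dense-∀< D hered dense zero Y Y⁺ Y⊆X = Y , id , Y⁺ , λ _ ()
      dense-∀< D hered dense (suc m) Y Y⁺ Y⊆X with dense-∀< D hered dense m Y Y⁺ Y⊆X
      ... | Z , Z⊆Y , Z⁺ , DZ with dense m Z Z⁺ (Y⊆X ∘ Z⊆Y)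
      ...   | W , W⊆Z , W⁺ , DmW = W , Z⊆Y ∘ W⊆Z , W⁺ , λ n n<1+m →
        case m<1+n⇒m<n∨m≡n n<1+m of λ where
          (inj₁ n<m)  → hered n W⊆Z (DZ n n<m)
          (inj₂ refl) → DmW

  -- Stems and Ellentuck neighbourhoods

  glue-cong : ∀ N {a a′ B B′} → Agree N a a′ → (∀ {k} → N ≤ k → B k ≡ B′ k) →
    glue N a B ≡ glue N a′ B′
  glue-cong N {a} {a′} {B} {B′} h h′ = ext λ k → case <-≤-connex k N of λ where
    (inj₁ k<N) → trans (glue-< {N} {a} {B} k<N) (trans (h k k<N) (sym (glue-< {N} {a′} {B′} k<N)))
    (inj₂ N≤k) → trans (glue-≥ {N} {a} {B} N≤k) (trans (h′ N≤k) (sym (glue-≥ {N} {a′} {B′} N≤k)))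

  glue-self : ∀ N B → glue N B B ≡ B
  glue-self N B = ext λ k → case <-≤-connex k N of λ where
    (inj₁ k<N) → glue-< {N} {B} {B} k<N
    (inj₂ N≤k) → glue-≥ {N} {B} {B} N≤k

  glue-∩ : ∀ N a B A → B ⊆[ N ] A → glue N a (B ∩ω A) ≡ glue N a B
  glue-∩ N a B A sub = glue-cong N (λ _ _ → refl) λ N≤k →
    Bool-ext (∈∩ˡ B A) (λ p → ∈∩⁺ B A p (sub N≤k p))

  singleton : ℕ → 𝒫ω
  singleton n k = does (k ≟ n)

  singleton-≢ : ∀ {n k} → ¬ (k ≡ n) → singleton n k ≡ false
  singleton-≢ {n} {k} = dec-false (k ≟ n)

  -- The Ellentuck neighbourhood with stem `a` below `N` and reservoir `A` is contained in `U`. What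
  -- `B` does below `N` is overwritten by the stem.
  Accept : Pred 𝒫ω 0ℓ → ℕ → 𝒫ω → Pred 𝒫ω 0ℓ
  Accept U N a A = ∀ B → Infinite B → B ⊆[ N ] A → U (glue N a B)

  Accept-mono : ∀ {U N a A A′} → A′ ⊆[ N ] A → Accept U N a A → Accept U N a A′
  Accept-mono sub acc B inf B⊆ = acc B inf λ N≤n p → sub N≤n (B⊆ N≤n p)

  Accept-local : ∀ {U N a a′ A} → Agree N a a′ → Accept U N a A → Accept U N a′ A
  Accept-local {U} {N} h acc B inf B⊆ =
    subst U (glue-cong N h λ _ → refl) (acc B inf B⊆)

  Homogeneous : Pred 𝒫ω 0ℓ → ℕ → 𝒫ω → Pred 𝒫ω 0ℓ
  Homogeneous U N a A = Accept U N a A ⊎ Accept (∁ U) N a A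

  Homogeneous-mono : ∀ {U N a A A′} → A′ ⊆[ N ] A → Homogeneous U N a A → Homogeneous U N a A′
  Homogeneous-mono {U} {N} {a} sub (inj₁ acc) = inj₁ (Accept-mono {U} {N} {a} sub acc)
  Homogeneous-mono {U} {N} {a} sub (inj₂ acc) = inj₂ (Accept-mono {∁ U} {N} {a} sub acc)

  Uniform : Pred 𝒫ω 0ℓ → Pred 𝒫ω 0ℓ
  Uniform U Y =
    (∀ B → Infinite B → El B ⊆ El Y → U B) ⊎ (∀ B → Infinite B → El B ⊆ El Y → ¬ U B)

  RamseySet : Pred 𝒫ω 0ℓ → Pred 𝒫ω 0ℓ → Set
  RamseySet I U = DenseBelow⁺ I (const true) (Uniform U)

  -- Distributivity from (DW)

  module _ (dw : DW) {I : Pred 𝒫ω 0ℓ} (good : Good I) where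
    open Good good

    ¬AddsReal : ¬ AddsReal I
    ¬AddsReal adds with dw I isIdeal tall borel adds
    ... | τ , isNew , X , X⁺ , width = CountableWidth.absurd isIdeal ramsey isNew X⁺ width

    abstract
      distributive : (D : ℕ → Pred 𝒫ω 0ℓ) →
        (∀ m Y → Y ∈ I ⁺ → ∃ λ Z → El Z ⊆ El Y × Z ∈ I ⁺ × D m Z) →
        ∃ λ Q → Q ∈ I ⁺ × ∃ λ (A : ℕ → 𝒫ω) → ∀ m → D m (A m) × I (Q ∖ω A m)
      distributive D dense = byContradiction λ ¬dist →
        ¬AddsReal (NewReal.τ isIdeal D dense ¬dist , NewReal.τ-new isIdeal D dense ¬dist)

  -- Diagonal intersections

  module Selectivity (dw : DW) {I : Pred 𝒫ω 0ℓ} (good : Good I) where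
    open Good good

    Diagonal : 𝒫ω → (ℕ → Pred 𝒫ω 0ℓ) → Set
    Diagonal X D = ∃ λ Z → El Z ⊆ El X × Z ∈ I ⁺ ×
      (∀ m → m ∈ El Z → ∃ λ A → D m A × Z ⊆[ suc m ] A)

    -- The colouring c {m < n} = [n ∈ A m] turns I-almost inclusion in every A m
    -- into a diagonal intersection.
    abstract
      diagonalise : ∀ X → X ∈ I ⁺ → (D : ℕ → Pred 𝒫ω 0ℓ) → (∀ m → DenseBelow⁺ I X (D m)) →
        Diagonal X D
      -- The families are dense only below `X`, so distributivity is applied to the restricted
      -- ideal.
      diagonalise X X⁺ D dense = from-Q (distributive dw (↾-good good X⁺) D dense↾)
        where
        dense↾ : ∀ m Y → Y ∈ (I ↾ X) ⁺ → ∃ λ Z → El Z ⊆ El Y × Z ∈ (I ↾ X) ⁺ × D m Z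
        dense↾ m Y Y⁺ = restrict (dense m (Y ∩ω X) Y⁺ (∈∩ʳ Y X))
          where
          restrict : (∃ λ Z → El Z ⊆ El (Y ∩ω X) × Z ∈ I ⁺ × D m Z) →
            ∃ λ Z → El Z ⊆ El Y × Z ∈ (I ↾ X) ⁺ × D m Z
          restrict (Z , Z⊆ , Z⁺ , DZ) =
            Z , ∈∩ˡ Y X ∘ Z⊆ , ⁺-mono (λ p → ∈∩⁺ Z X p (∈∩ʳ Y X (Z⊆ p))) Z⁺ , DZ

        from-Q : (∃ λ Q → Q ∈ (I ↾ X) ⁺ × ∃ λ (A : ℕ → 𝒫ω) → ∀ m → D m (A m) × (I ↾ X) (Q ∖ω A m)) →
          Diagonal X D
        from-Q (Q , QX⁺ , A , hA) = from-Z (ramsey (Q ∩ω X) QX⁺ A)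
          where
          from-Z : (∃ λ Z → El Z ⊆ El (Q ∩ω X) × Z ∈ I ⁺ × HomogeneousFor A Z) → Diagonal X D
          from-Z (Z , Z⊆ , Z⁺ , true , hom) = Z , ∈∩ʳ Q X ∘ Z⊆ , Z⁺ , λ m m∈ →
            A m , proj₁ (hA m) , λ {n} m<n n∈ → hom m n m∈ n∈ m<n
          -- For any `m` in `Z`, colour `false` would keep `Z` beyond `m` out of `A m`; but `Q ∩ω X`
          -- is almost included in `A m`, so `Z` would be in `I`.
          from-Z (Z , Z⊆ , Z⁺ , false , hom) =
            contradiction (Z-small (Infinite⇒unbounded (⁺⇒Infinite Z⁺) 0)) Z⁺
            where
            Z-small : (∃ λ m → 0 ≤ m × m ∈ El Z) → I Z
            Z-small (m , _ , m∈) = small {suc m} {Z} {(Q ∖ω A m) ∩ω X} (λ {n} m<n n∈ →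
              ∈∩⁺ (Q ∖ω A m) X
                (∈∖⁺ Q (A m) (∈∩ˡ Q X (Z⊆ n∈)) (not-¬ (hom m n m∈ n∈ m<n)))
                (∈∩ʳ Q X (Z⊆ n∈)))
              (proj₂ (hA m))

    -- Open sets are Ramsey

    module OpenSets {U : Pred 𝒫ω 0ℓ} (open-U : Open U) where

      -- As in Galvin and Prikry, rejection passes to positive subsets, so every positive set can be
      -- shrunk to one that accepts or rejects.
      Reject : ℕ → 𝒫ω → Pred 𝒫ω 0ℓ
      Reject N a A = ∀ Z → Z ∈ I ⁺ → Z ⊆[ N ] A → ¬ Accept U N a Z

      Decided : ℕ → 𝒫ω → Pred 𝒫ω 0ℓ
      Decided N a A = Accept U N a A ⊎ Reject N a A

      Reject-local : ∀ {N a a′ A} → Agree N a a′ → Reject N a A → Reject N a′ A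
      Reject-local {N} h rej Z Z⁺ Z⊆ acc =
        rej Z Z⁺ Z⊆ (Accept-local {U} {N} (λ m m<N → sym (h m m<N)) acc)

      Decided-mono : ∀ {N a A A′} → A′ ⊆[ N ] A → Decided N a A → Decided N a A′
      Decided-mono {N} {a} sub (inj₁ acc) = inj₁ (Accept-mono {U} {N} {a} sub acc)
      Decided-mono sub (inj₂ rej) =
        inj₂ λ Z Z⁺ Z⊆ → rej Z Z⁺ λ N≤n p → sub N≤n (Z⊆ N≤n p)

      Decided-local : ∀ {N a a′ A} → Agree N a a′ → Decided N a A → Decided N a′ A
      Decided-local {N} h (inj₁ acc) = inj₁ (Accept-local {U} {N} h acc)
      Decided-local {N} h (inj₂ rej) = inj₂ (Reject-local {N} h rej)

      abstract
        decided-dense : ∀ X N a → DenseBelow⁺ I X (Decided N a)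
        decided-dense X N a Y Y⁺ _ with dec (∃ λ Z → Z ∈ I ⁺ × Z ⊆[ N ] Y × Accept U N a Z)
        -- `Z` lies in `Y` only from `N` on; acceptance and positivity survive the intersection with
        -- `Y`.
        ... | yes (Z , Z⁺ , Z⊆ , acc) = Z ∩ω Y , ∈∩ʳ Z Y , ⁺-∩ Y Z Z⊆ Z⁺ ,
          inj₁ (Accept-mono {U} {N} {a} (λ _ → ∈∩ˡ Z Y) acc)
        ... | no none = Y , id , Y⁺ , inj₂ λ Z Z⁺ Z⊆ acc → none (Z , Z⁺ , Z⊆ , acc)

      module Fusion (Z : 𝒫ω) (Z⁺ : Z ∈ I ⁺)
        (decides : ∀ m → m ∈ El Z → ∀ a → Decided (suc m) a Z) where

        -- Read as a stem of length `suc n`: after `a` below `N`, the next element of the set is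
        -- `n`.
        extendStem : ℕ → 𝒫ω → ℕ → 𝒫ω
        extendStem N a n = glue N a (singleton n)

        -- The reservoir `Z` stays fixed; only the set `A` of admissible next elements shrinks.
        RejectsExtensions : ℕ → 𝒫ω → Pred 𝒫ω 0ℓ
        RejectsExtensions N a A = Reject N a Z →
          ∀ n → N ≤ n → n ∈ El A → Reject (suc n) (extendStem N a n) Z

        RejectsExtensions-local : ∀ {N a a′ A} → Agree N a a′ →
          RejectsExtensions N a A → RejectsExtensions N a′ A
        RejectsExtensions-local {N} {a} {a′} h rejs rej n N≤n n∈ =
          subst (λ s → Reject (suc n) s Z) (glue-cong N h λ _ → refl)
            (rejs (Reject-local {N} (λ m m<N → sym (h m m<N)) rej) n N≤n n∈)

        -- If Z accepted the extensions of the stem by positively many n, these n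
        -- would form a positive set accepting the stem itself.
        abstract
          rejectsExtensions-dense : ∀ N a → DenseBelow⁺ I Z (RejectsExtensions N a)
          rejectsExtensions-dense N a Y Y⁺ Y⊆Z with dec (Reject N a Z)
          ... | no ¬rej = Y , id , Y⁺ , λ rej → contradiction rej ¬rej
          ... | yes rej = Y ∖ω ⟦ Bad ⟧ , ∈∖ˡ Y ⟦ Bad ⟧ , ⁺-∖ Y ⟦ Bad ⟧ Y⁺ bad-small ,
            λ _ n N≤n n∈ → case decides n (Y⊆Z (∈∖ˡ Y ⟦ Bad ⟧ n∈)) (extendStem N a n) of λ where
              (inj₁ acc)  → contradiction
                (⟦⟧⁺ Bad (∈∖ˡ Y ⟦ Bad ⟧ n∈ , acc)) (∈∖ʳ Y ⟦ Bad ⟧ n∈)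
              (inj₂ rej′) → rej′
            where
            Bad : Pred ℕ 0ℓ
            Bad n = n ∈ El Y × Accept U (suc n) (extendStem N a n) Z

            -- The first element `n` of `B` from `N` on is bad, and the stem extended by `n` and
            -- continued by `B` is just the stem continued by `B`.
            bad-accepts : Accept U N a ⟦ Bad ⟧
            bad-accepts B inf B⊆ with firstFrom B N (Infinite⇒unbounded inf N)
            ... | n , N≤n , n∈ , gap = subst U (ext same)
              (proj₂ (⟦⟧⁻ Bad (B⊆ N≤n n∈)) B inf λ {k} n<k k∈ →
                Y⊆Z (proj₁ (⟦⟧⁻ Bad (B⊆ (≤-trans N≤n (<⇒≤ n<k)) k∈))))
              where
              same : ∀ k → glue (suc n) (extendStem N a n) B k ≡ glue N a B k
              same k with <-≤-connex k N
              ... | inj₁ k<N = trans (glue-< {suc n} {extendStem N a n} {B} (<-≤-trans k<N (≤-trans N≤n (n≤1+n n))))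
                (trans (glue-< {N} {a} {singleton n} k<N) (sym (glue-< {N} {a} {B} k<N)))
              ... | inj₂ N≤k with <-cmp k n
              ...   | tri< k<n k≢n _ = trans (glue-< {suc n} {extendStem N a n} {B} (<-trans k<n (n<1+n n)))
                (trans (glue-≥ {N} {a} {singleton n} N≤k)
                  (trans (singleton-≢ k≢n) (trans (sym (gap k N≤k k<n)) (sym (glue-≥ {N} {a} {B} N≤k)))))
              ...   | tri≈ _ refl _ = trans (glue-< {suc n} {extendStem N a n} {B} (n<1+n n))
                (trans (glue-≥ {N} {a} {singleton n} N≤k)
                  (trans (dec-true (n ≟ n) refl) (trans (sym n∈) (sym (glue-≥ {N} {a} {B} N≤k)))))
              ...   | tri> _ _ n<k = trans (glue-≥ {suc n} {extendStem N a n} {B} n<k)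
                (sym (glue-≥ {N} {a} {B} N≤k))

            bad-small : I ⟦ Bad ⟧
            bad-small = byContradiction λ pos →
              rej ⟦ Bad ⟧ pos (λ _ p → Y⊆Z (proj₁ (⟦⟧⁻ Bad p))) bad-accepts

        module Avoid (root : Reject 0 (const false) Z) where

          AllRejectExtensions : ℕ → Pred 𝒫ω 0ℓ
          AllRejectExtensions m A = ∀ a → RejectsExtensions (suc m) a A

          allRejectExtensions-dense : ∀ V → El V ⊆ El Z → ∀ m → DenseBelow⁺ I V (AllRejectExtensions m)
          allRejectExtensions-dense V V⊆Z m = dense-∀stems (suc m) (RejectsExtensions (suc m))
            (λ a sub rejs rej n m<n n∈ → rejs rej n m<n (sub n∈))
            (λ {a} {a′} {A} → RejectsExtensions-local {suc m} {a} {a′} {A})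
            (λ a Y Y⁺ Y⊆V → rejectsExtensions-dense (suc m) a Y Y⁺ (V⊆Z ∘ Y⊆V))

          -- A nonempty stem ends in an element `m` of `W` and has length `suc m`; the empty stem,
          -- of length 0, is treated apart.
          FusedIn : 𝒫ω → Set
          FusedIn Y = ∃ λ W → El W ⊆ El Y × W ∈ I ⁺ × RejectsExtensions 0 (const false) W ×
            (∀ m → m ∈ El W → AllRejectExtensions m W)

          abstract
            fused : FusedIn Z
            fused = start (rejectsExtensions-dense 0 (const false) Z Z⁺ id)
              where
              start : (∃ λ V → El V ⊆ El Z × V ∈ I ⁺ × RejectsExtensions 0 (const false) V) → FusedIn Z
              start (V , V⊆Z , V⁺ , rejV) =
                refine (diagonalise V V⁺ AllRejectExtensions (allRejectExtensions-dense V V⊆Z))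
                where
                refine : Diagonal V AllRejectExtensions → FusedIn Z
                refine (W , W⊆V , W⁺ , hW) = W , V⊆Z ∘ W⊆V , W⁺ ,
                  (λ rej n 0≤n n∈ → rejV rej n 0≤n (W⊆V n∈)) ,
                  λ m m∈ → spread m (hW m m∈)
                  where
                  spread : ∀ m → (∃ λ A → AllRejectExtensions m A × W ⊆[ suc m ] A) →
                    AllRejectExtensions m W
                  spread m (A , rejs , W⊆A) a rej n m<n n∈ = rejs a rej n m<n (W⊆A m<n n∈)

          W : 𝒫ω
          W = proj₁ fused

          extendStem-Agree : ∀ {B N m} a → Agree N a B → m ∈ El B → N ≤ m →
            (∀ k → N ≤ k → k < m → B k ≡ false) → Agree (suc m) (extendStem N a m) B
          extendStem-Agree {B} {N} {m} a h m∈ N≤m gap k k<1+m with <-≤-connex k N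
          ... | inj₁ k<N = trans (glue-< {N} {a} {singleton m} k<N) (h k k<N)
          ... | inj₂ N≤k with m<1+n⇒m<n∨m≡n k<1+m
          ...   | inj₁ k<m = trans (glue-≥ {N} {a} {singleton m} N≤k)
            (trans (singleton-≢ (<⇒≢ k<m)) (sym (gap k N≤k k<m)))
          ...   | inj₂ refl = trans (glue-≥ {N} {a} {singleton m} N≤k)
            (trans (dec-true (m ≟ m) refl) (sym m∈))

          -- Rejection climbs along `B`: the initial segment through `m` extends the one through the
          -- preceding element of `B`, or the empty stem if `m` is the first.
          rejects-initial : ∀ B → El B ⊆ El W → ∀ m → m ∈ El B → Reject (suc m) B Z
          rejects-initial B B⊆W = <-rec (λ m → m ∈ El B → Reject (suc m) B Z) λ m ih m∈ →
            let (_ , _ , _ , rej₀ , rejₛ) = fused in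
            case predecessor B m of λ where
              (inj₁ gap) → Reject-local {suc m}
                (extendStem-Agree (const false) (λ _ ()) m∈ z≤n (λ k _ → gap k))
                (rej₀ root m z≤n (B⊆W m∈))
              (inj₂ (l , l<m , l∈ , gap)) → Reject-local {suc m}
                (extendStem-Agree B (λ _ _ → refl) m∈ l<m gap)
                (rejₛ l (B⊆W l∈) B (ih l<m l∈) m l<m (B⊆W m∈))

          -- By openness a long enough initial segment of `B` would already force membership in `U`,
          -- so `Z` would accept a stem that it rejects.
          avoids : ∀ B → Infinite B → El B ⊆ El W → ¬ U B
          avoids B inf B⊆W B∈U with open-U B B∈U
          ... | n , nbhd with Infinite⇒unbounded inf n
          ...   | m , n≤m , m∈ = rejects-initial B B⊆W m m∈ Z Z⁺ (λ _ → id) λ B′ _ _ →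
            nbhd _ λ k k<n → sym (glue-< {suc m} {B} {B′} (<-trans k<n (s≤s n≤m)))

      AllDecided : ℕ → Pred 𝒫ω 0ℓ
      AllDecided m A = ∀ a → Decided (suc m) a A

      allDecided-dense : ∀ X m → DenseBelow⁺ I X (AllDecided m)
      allDecided-dense X m = dense-∀stems (suc m) (Decided (suc m))
        (λ a sub → Decided-mono {suc m} {a} (λ _ → sub))
        (λ {a} {a′} {A} → Decided-local {suc m} {a} {a′} {A})
        (decided-dense X (suc m))

      abstract
        -- The empty stem is decided first; diagonalising then decides all stems that end in an
        -- element of `Z`. Acceptance of the empty stem is one alternative, and its rejection leads
        -- by fusion to the other.
        ramsey-open : RamseySet I U
        ramsey-open X X⁺ _ = from-root (decided-dense X 0 (const false) X X⁺ id)
          where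
          Goal : 𝒫ω → Set
          Goal X = ∃ λ Y → El Y ⊆ El X × Y ∈ I ⁺ × Uniform U Y

          from-decided : ∀ Z → Z ∈ I ⁺ → (∀ m → m ∈ El Z → AllDecided m Z) →
            Decided 0 (const false) Z → Goal Z
          from-decided Z Z⁺ _ (inj₁ acc) = Z , id , Z⁺ , inj₁ λ B inf B⊆ → acc B inf λ _ → B⊆
          from-decided Z Z⁺ decides (inj₂ rej) =
              W , proj₁ (proj₂ fused) , proj₁ (proj₂ (proj₂ fused)) , inj₂ avoids
            where
            open Fusion Z Z⁺ decides
            open Avoid rej

          from-root : (∃ λ X′ → El X′ ⊆ El X × X′ ∈ I ⁺ × Decided 0 (const false) X′) → Goal X
          from-root (X′ , X′⊆X , X′⁺ , root) =
            from-diagonal (diagonalise X′ X′⁺ AllDecided (allDecided-dense X′))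
            where
            from-diagonal : Diagonal X′ AllDecided → Goal X
            from-diagonal (Z , Z⊆X′ , Z⁺ , hZ) = enlarge (from-decided Z Z⁺ (λ m m∈ → decides m (hZ m m∈))
                (Decided-mono {0} {const false} (λ _ → Z⊆X′) root))
              where
              decides : ∀ m → (∃ λ A → AllDecided m A × Z ⊆[ suc m ] A) → AllDecided m Z
              decides m (A , dec-A , Z⊆A) a = Decided-mono {suc m} {a} Z⊆A (dec-A a)
              enlarge : Goal Z → Goal X
              enlarge (Y , Y⊆Z , rest) = Y , X′⊆X ∘ Z⊆X′ ∘ Y⊆Z , rest

    -- Countable unions of Ramsey sets

    abstract
      -- Prescribing a stem is a substitution by `glue`. A set that lies in `Z` only from `N` on may
      -- be cut down to `Z`, since `glue` ignores its part below `N`.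
      Homogeneous-dense : ∀ {U} X N a → RamseySet I (U ∘ glue N a) →
        DenseBelow⁺ I X (Homogeneous U N a)
      Homogeneous-dense {U} X N a R Y Y⁺ _ with R Y Y⁺ (λ _ → refl)
      ... | Z , Z⊆Y , Z⁺ , inj₁ h = Z , Z⊆Y , Z⁺ , inj₁ λ B inf B⊆ →
        subst U (glue-∩ N a B Z B⊆) (h (B ∩ω Z) (Infinite-∩ Z B B⊆ inf) (∈∩ʳ B Z))
      ... | Z , Z⊆Y , Z⁺ , inj₂ h = Z , Z⊆Y , Z⁺ , inj₂ λ B inf B⊆ →
        subst (∁ U) (glue-∩ N a B Z B⊆) (h (B ∩ω Z) (Infinite-∩ Z B B⊆ inf) (∈∩ʳ B Z))

    -- On a suitable positive Z, membership in U n of an infinite subset is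
    -- determined by an initial segment, so the union is relatively open in [Z]^ω.
    module Unions (U : ℕ → Pred 𝒫ω 0ℓ) (R : ∀ n N a → RamseySet I (U n ∘ glue N a)) where

      -- Only finitely many sets are treated at stage `m`; `U n` is handled at every element `m`
      -- with `n ≤ m`, of which an infinite set has one.
      AllHomogeneous : ℕ → Pred 𝒫ω 0ℓ
      AllHomogeneous m A = ∀ n → n < suc m → ∀ a → Homogeneous (U n) (suc m) a A

      Homogeneous-local : ∀ n m {a a′ A} → Agree (suc m) a a′ →
        Homogeneous (U n) (suc m) a A → Homogeneous (U n) (suc m) a′ A
      Homogeneous-local n m h (inj₁ acc) = inj₁ (Accept-local {U n} {suc m} h acc)
      Homogeneous-local n m h (inj₂ acc) = inj₂ (Accept-local {∁ (U n)} {suc m} h acc)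

      abstract
        allHomogeneous-dense : ∀ X m → DenseBelow⁺ I X (AllHomogeneous m)
        allHomogeneous-dense X m = dense-∀< (λ n A → ∀ a → Homogeneous (U n) (suc m) a A)
          (λ n sub hom a → Homogeneous-mono {U n} {suc m} {a} (λ _ → sub) (hom a))
          (λ n → dense-∀stems (suc m) (Homogeneous (U n) (suc m))
            (λ a sub → Homogeneous-mono {U n} {suc m} {a} (λ _ → sub))
            (λ {a} {a′} {A} → Homogeneous-local n m {a} {a′} {A})
            (λ a → Homogeneous-dense {U n} X (suc m) a (R n (suc m) a)))
          (suc m)

      -- Defined for every `B`, so that it is open in the whole space; on the infinite subsets of
      -- the diagonal set `Z` it coincides with the union.
      Determined : 𝒫ω → Pred 𝒫ω 0ℓ
      Determined Z B = ∃ λ m → ∃ λ n → Accept (U n) (suc m) B Z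

      Determined-open : ∀ Z → Open (Determined Z)
      Determined-open Z B (m , n , acc) =
        suc m , λ B′ h → m , n , Accept-local {U n} {suc m} h acc

      abstract
        ramsey-⋃ : RamseySet I (⋃ ℕ U)
        ramsey-⋃ X X⁺ _ = from-diagonal (diagonalise X X⁺ AllHomogeneous (allHomogeneous-dense X))
          where
          Goal : Set
          Goal = ∃ λ Y → El Y ⊆ El X × Y ∈ I ⁺ × Uniform (⋃ ℕ U) Y

          from-diagonal : Diagonal X AllHomogeneous → Goal
          from-diagonal (Z , Z⊆X , Z⁺ , hZ) =
            from-open (OpenSets.ramsey-open (Determined-open Z) Z Z⁺ (λ _ → refl))
            where
            from-open : (∃ λ Y → El Y ⊆ El Z × Y ∈ I ⁺ × Uniform (Determined Z) Y) → Goal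
            from-open (Y , Y⊆Z , Y⁺ , inj₁ h) = Y , Z⊆X ∘ Y⊆Z , Y⁺ , inj₁ λ B inf B⊆ →
              inside B inf (Y⊆Z ∘ B⊆) (h B inf B⊆)
              where
              inside : ∀ B → Infinite B → El B ⊆ El Z → Determined Z B → B ∈ ⋃ ℕ U
              inside B inf B⊆Z (m , n , acc) =
                n , subst (U n) (glue-self (suc m) B) (acc B inf λ _ → B⊆Z)
            from-open (Y , Y⊆Z , Y⁺ , inj₂ h) = Y , Z⊆X ∘ Y⊆Z , Y⁺ , inj₂ λ B inf B⊆ (n , B∈U) →
              h B inf B⊆ (determined B inf (Y⊆Z ∘ B⊆) n B∈U (Infinite⇒unbounded inf n))
              where
              determined : ∀ B → Infinite B → El B ⊆ El Z → ∀ n → U n B →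
                (∃ λ m → n ≤ m × m ∈ El B) → Determined Z B
              determined B inf B⊆Z n B∈U (m , n≤m , m∈) = from-A (hZ m (B⊆Z m∈))
                where
                from-homogeneous : Homogeneous (U n) (suc m) B Z → Determined Z B
                from-homogeneous (inj₁ acc)  = m , n , acc
                from-homogeneous (inj₂ ¬acc) = contradiction
                  (subst (U n) (sym (glue-self (suc m) B)) B∈U) (¬acc B inf (λ _ → B⊆Z))
                from-A : (∃ λ A → AllHomogeneous m A × Z ⊆[ suc m ] A) → Determined Z B
                from-A (A , homs , Z⊆A) = from-homogeneous
                  (Homogeneous-mono {U n} {suc m} {B} Z⊆A (homs n (s≤s n≤m) B))

    -- The continuous map `f` strengthens the induction: a union needs its pieces Ramsey under every
    -- prescribed stem, that is, after composition with `glue N a`.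
    ramsey-borel : ∀ {U} → Borel U → ∀ f → Continuous f → RamseySet I (U ∘ f)
    ramsey-borel (open-set op) f fc = OpenSets.ramsey-open (Open-preimage fc op)
    ramsey-borel (complement b) f fc Y Y⁺ Y⊆ with ramsey-borel b f fc Y Y⁺ Y⊆
    ... | Z , Z⊆Y , Z⁺ , inj₁ h = Z , Z⊆Y , Z⁺ , inj₂ λ B inf B⊆ ¬u → ¬u (h B inf B⊆)
    ... | Z , Z⊆Y , Z⁺ , inj₂ h = Z , Z⊆Y , Z⁺ , inj₁ h
    ramsey-borel (union {U} b) f fc = Unions.ramsey-⋃ (λ n → U n ∘ f) λ n N a →
      ramsey-borel (b n) (f ∘ glue N a) (∘-continuous fc (glue-continuous N a))
    ramsey-borel (resp (U⊆V , V⊆U) b) f fc Y Y⁺ Y⊆ with ramsey-borel b f fc Y Y⁺ Y⊆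
    ... | Z , Z⊆Y , Z⁺ , inj₁ h = Z , Z⊆Y , Z⁺ , inj₁ λ B inf B⊆ → U⊆V (h B inf B⊆)
    ... | Z , Z⊆Y , Z⁺ , inj₂ h = Z , Z⊆Y , Z⁺ , inj₂ λ B inf B⊆ v → h B inf B⊆ (V⊆U v)

    inconsistent : Absurdity
    inconsistent with ramsey-borel borel id id-continuous (const true) proper (λ _ → refl)
    ... | Y , _ , Y⁺ , inj₁ h = Y⁺ (h Y (⁺⇒Infinite Y⁺) id)
    ... | Y , _ , Y⁺ , inj₂ h with tall Y (⁺⇒Infinite Y⁺)
    ...   | B , B⊆Y , inf , B∈I = h B inf B⊆Y B∈I

corollary7p4 : ExcludedMiddle (Level.suc 0ℓ) → Extensionality 0ℓ 0ℓ → DW →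
    ¬ (∃ λ I → IsIdeal I × Tall I × Borel I × Ramsey I)
corollary7p4 em ext dw (I , isIdeal , tall , borel , ramsey) =
  Classical.Selectivity.inconsistent em ext dw
    (record { isIdeal = isIdeal ; tall = tall ; borel = borel ; ramsey = ramsey })
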